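{- An odd prime $p$ is G-regular if and only if it is B-regular and satisfies $\operatorname{ord}_p(4)=(p-1)/2$.
   Context: Bernoulli numbers $B_n$ are defined by $\frac{t}{e^t-1}=\sum_{n\ge0}B_n\frac{t^n}{n!}$. An odd prime $p$ is B-irregular if $p$ divides the numerator of at least one of $B_2,B_4,\ldots,B_{p-3}$, and B-regular otherwise. Genocchi numbers $G_n$ are defined by $\frac{2t}{e^t+1}=\sum_{n\ge 1}G_n\frac{t^n}{n!}$; an odd prime $p$ is G-irregular if it divides at least one of the integers $G_2,G_4,\ldots,G_{p-3}$, and G-regular otherwise. For an odd prime $p$ and integer $g$ with $p\nmid g$, $\operatorname{ord}_p(g)$ is the multiplicative order of $g$ modulo $p$. -}

module Defs where

open import Data.Nat as ℕ using (ℕ; zero; suc; _≤_; _<_; _^_; _%_; _∸_)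
open import Data.Nat.Combinatorics using (_C_)
open import Data.Nat.Divisibility as ℕD using ()
open import Data.Nat.Primality using (Prime)
open import Data.Integer as ℤ using (ℤ; +_)
open import Data.Integer.Divisibility as ℤD using ()
open import Data.Rational as ℚ using (ℚ; 0ℚ; 1ℚ; _+_; _*_; -_; _/_; ↥_)
open import Data.List using (List; []; _∷_; _++_; [_])
open import Data.Product using (_×_)
open import Relation.Binary.PropositionalEquality using (_≡_; _≢_)
open import Relation.Nullary using (¬_)

prefix : (ℕ → List ℚ → ℚ) → ℕ → List ℚ
prefix f zero = []
prefix f (suc n) = let xs = prefix f n in xs ++ [ f n xs ]

wsumFrom : ℕ → (ℕ → ℚ) → List ℚ → ℚ
wsumFrom i w [] = 0ℚ
wsumFrom i w (x ∷ xs) = w i * x + wsumFrom (suc i) w xs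

wsum : (ℕ → ℚ) → List ℚ → ℚ
wsum = wsumFrom 0

natℚ : ℕ → ℚ
natℚ n = + n / 1

δ : ℕ → ℕ → ℚ
δ m n with m ℕ.≟ n
... | Relation.Nullary.yes _ = 1ℚ
... | Relation.Nullary.no _ = 0ℚ

-- Coefficient of t^(n+1)/(n+1)! in  t = (e^t - 1) Σ B_k t^k/k! :
--   Σ_{k=0}^{n} C(n+1,k) B_k = [n = 0]
bernStep : ℕ → List ℚ → ℚ
bernStep n xs = (+ 1 / suc n) * (δ n 0 + - wsum (λ k → natℚ (suc n C k)) xs)

-- Bernoulli number B_n (with B_1 = -1/2), as a rational
B : ℕ → ℚ
B n = bernStep n (prefix bernStep n)

-- Coefficient of t^n/n! in  2t = (e^t + 1) Σ G_k t^k/k! :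
--   Σ_{k=0}^{n} C(n,k) G_k + G_n = 2 [n = 1]
genStep : ℕ → List ℚ → ℚ
genStep n xs = (+ 1 / 2) * (natℚ 2 * δ n 1 + - wsum (λ k → natℚ (n C k)) xs)

-- Genocchi number G_n (G_0 = 0, G_1 = 1, G_2 = -1, …), as a rational (it is an integer)
G : ℕ → ℚ
G n = genStep n (prefix genStep n)

_∣num_ : ℕ → ℚ → Set
p ∣num q = (+ p) ℤD.∣ (↥ q)

OddPrime : ℕ → Set
OddPrime p = Prime p × p ≢ 2

BRegular : ℕ → Set
BRegular p = ∀ j → 1 ≤ j → 2 ℕ.* j ≤ p ∸ 3 → ¬ (p ∣num B (2 ℕ.* j))

GRegular : ℕ → Set
GRegular p = ∀ j → 1 ≤ j → 2 ℕ.* j ≤ p ∸ 3 → ¬ (p ∣num G (2 ℕ.* j))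

-- k is the multiplicative order of g modulo p (p ≥ 2): least positive k with g^k ≡ 1 (mod p)
-- (g^k ≡ 1 mod p is written p ∣ g^k - 1; g^k ≥ 1 when p ∤ g so truncated ∸ is exact)
IsOrd : (p g k : ℕ) → Set
IsOrd p g k = (0 < k) × (p ℕD.∣ (g ^ k ∸ 1))
              × (∀ j → 0 < j → j < k → ¬ (p ℕD.∣ (g ^ j ∸ 1)))

{-# OPTIONS --safe #-}
module Submission where

-- From 2t/(e^t + 1) = 2 (t/(e^t - 1) - 2t/(e^{2t} - 1)) one gets G_n = 2 (1 - 2^n) B_n. For 2j ≤ p - 3
-- the recursion for B_{2j} only divides by integers below p, so B_{2j} is p-integral and
-- p ∣ G_{2j} iff p ∣ 4^j - 1 or p ∣ B_{2j}. Since 4^{(p-1)/2} ≡ 1 (mod p) by Fermat, p ∤ 4^j - 1 for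
-- all 1 ≤ j ≤ (p-3)/2 means exactly that ord_p(4) = (p-1)/2.
-- The Genocchi-Bernoulli relation is checked without dividing power series: both sides X satisfy
-- (e^{2t} - 1) X = 2t (e^t - 1).

open import Defs
open import Data.Nat as ℕ using (ℕ; zero; suc; z≤n; s≤s; _∸_; _/_)
open import Data.Nat.Combinatorics using (_C_; nCn≡1; nC1≡n; nCk≡nC[n∸k]; nCk+nC[k+1]≡[n+1]C[k+1])
open import Data.Nat.Combinatorics.Specification using (k>n⇒nCk≡0)
import Data.Nat.Coprimality as Coprimality
open import Data.Nat.Divisibility using (_∣_; _∤_; divides; ∣-trans; ∣⇒≤; ∣1⇒≡1; m∣m*n; ∣m⇒∣m*n; ∣n⇒∣m*n; ∣m∣n⇒∣m+n; _∣0)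
import Data.Nat.DivMod as DivMod
open import Data.Nat.Primality using (Prime; euclidsLemma; prime⇒irreducible; ¬prime[1]; prime[2])
import Data.Nat.Properties as ℕP
open import Data.Nat.Tactic.RingSolver using (solve-∀)
open import Data.Integer as ℤ using (ℤ)
import Data.Integer.GCD as ℤGCD
import Data.Integer.Properties as ℤP
open import Data.Rational as ℚ using (ℚ; mkℚ; 0ℚ; 1ℚ; _+_; _*_; -_; ↥_; ↧_; ↧ₙ_)
import Data.Rational.Properties as ℚP
open import Data.Rational.Solver using (module +-*-Solver)
open +-*-Solver using (solve; _:=_; _:+_; _:*_; :-_; con)
open import Data.List using ([]; _∷_; _++_; [_]; length)
open import Data.List.Properties using (length-++)
open import Data.Product using (_×_; _,_; ∃)
open import Data.Sum using (_⊎_; inj₁; inj₂; [_,_]′)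
open import Data.Empty using (⊥-elim)
open import Function using (_∘_; id)
open import Function.Bundles using (_⇔_; mk⇔; module Equivalence)
open import Relation.Nullary using (yes; no; contradiction)
open import Relation.Binary.PropositionalEquality using (_≡_; _≢_; refl; sym; trans; cong; cong₂; subst; module ≡-Reasoning)
open ≡-Reasoning

-- Naturals inside the rationals.

natℚ-coprime : ∀ n → natℚ n ≡ mkℚ (ℤ.+ n) 0 (Coprimality.sym (Coprimality.1-coprimeTo n))
natℚ-coprime n = ℚP.normalize-coprime _

natℚ-+ : ∀ m n → natℚ (m ℕ.+ n) ≡ natℚ m + natℚ n
natℚ-+ m n rewrite natℚ-coprime m | natℚ-coprime n =
  cong (ℚ._/ 1) (sym (cong₂ ℤ._+_ (ℤP.*-identityʳ (ℤ.+ m)) (ℤP.*-identityʳ (ℤ.+ n))))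

natℚ-* : ∀ m n → natℚ (m ℕ.* n) ≡ natℚ m * natℚ n
natℚ-* m n rewrite natℚ-coprime m | natℚ-coprime n =
  cong (ℚ._/ 1) (ℤP.pos-* m n)

-- Exponential generating functions and multiplication by e^t.

-- On exponential generating functions T is multiplication by e^t; X ∘ suc is the derivative of X.
T : (ℕ → ℚ) → ℕ → ℚ
T X zero = X zero
T X (suc n) = T X n + T (X ∘ suc) n

T-cong : ∀ {X Y} → (∀ n → X n ≡ Y n) → ∀ n → T X n ≡ T Y n
T-cong X≗Y zero = X≗Y zero
T-cong X≗Y (suc n) = cong₂ _+_ (T-cong X≗Y n) (T-cong (X≗Y ∘ suc) n)

T-+ : ∀ X Y n → T (λ k → X k + Y k) n ≡ T X n + T Y n
T-+ X Y zero = refl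
T-+ X Y (suc n) = begin
  T (λ k → X k + Y k) n + T (λ k → X (suc k) + Y (suc k)) n
    ≡⟨ cong₂ _+_ (T-+ X Y n) (T-+ (X ∘ suc) (Y ∘ suc) n) ⟩
  (T X n + T Y n) + (T (X ∘ suc) n + T (Y ∘ suc) n)
    ≡⟨ solve 4 (λ a b c d → (a :+ b) :+ (c :+ d) := (a :+ c) :+ (b :+ d)) refl
         (T X n) (T Y n) (T (X ∘ suc) n) (T (Y ∘ suc) n) ⟩
  T X (suc n) + T Y (suc n) ∎

T-*ₗ : ∀ c X n → T (λ k → c * X k) n ≡ c * T X n
T-*ₗ c X zero = refl
T-*ₗ c X (suc n) = begin
  T (λ k → c * X k) n + T (λ k → c * X (suc k)) n
    ≡⟨ cong₂ _+_ (T-*ₗ c X n) (T-*ₗ c (X ∘ suc) n) ⟩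
  c * T X n + c * T (X ∘ suc) n
    ≡⟨ sym (ℚP.*-distribˡ-+ c (T X n) (T (X ∘ suc) n)) ⟩
  c * T X (suc n) ∎

2ℚ : ℚ
2ℚ = natℚ 2

-- X(t) ↦ X(2t) on exponential generating functions.
S : (ℕ → ℚ) → ℕ → ℚ
S X n = natℚ (2 ℕ.^ n) * X n

S-suc : ∀ X n → S X (suc n) ≡ 2ℚ * S (X ∘ suc) n
S-suc X n = trans (cong (_* X (suc n)) (natℚ-* 2 (2 ℕ.^ n)))
                  (ℚP.*-assoc 2ℚ (natℚ (2 ℕ.^ n)) (X (suc n)))

-- e^{2t} · X(2t) = (e^t · X)(2t).
T²-scale : ∀ X n → T (T (S X)) n ≡ S (T X) n
T²-scale X zero = refl
T²-scale X (suc n) = begin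
  T (T (S X)) n + T (λ k → T (S X) k + T (S X ∘ suc) k) n
    ≡⟨ cong (λ x → T (T (S X)) n + x) (T-+ (T (S X)) (T (S X ∘ suc)) n) ⟩
  T (T (S X)) n + (T (T (S X)) n + T (T (S X ∘ suc)) n)
    ≡⟨ cong (λ x → T (T (S X)) n + (T (T (S X)) n + x)) shifted ⟩
  T (T (S X)) n + (T (T (S X)) n + 2ℚ * T (T (S (X ∘ suc))) n)
    ≡⟨ cong₂ (λ x y → x + (x + 2ℚ * y)) (T²-scale X n) (T²-scale (X ∘ suc) n) ⟩
  S (T X) n + (S (T X) n + 2ℚ * S (T (X ∘ suc)) n)
    ≡⟨ solve 3 (λ w a b → w :* a :+ (w :* a :+ con 2ℚ :* (w :* b)) := con 2ℚ :* (w :* (a :+ b))) refl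
         (natℚ (2 ℕ.^ n)) (T X n) (T (X ∘ suc) n) ⟩
  2ℚ * (natℚ (2 ℕ.^ n) * T X (suc n))
    ≡⟨ sym (S-suc (T X) n) ⟩
  S (T X) (suc n) ∎
  where
  shifted : T (T (S X ∘ suc)) n ≡ 2ℚ * T (T (S (X ∘ suc))) n
  shifted = begin
    T (T (S X ∘ suc)) n                       ≡⟨ T-cong (T-cong (S-suc X)) n ⟩
    T (T (λ k → 2ℚ * S (X ∘ suc) k)) n        ≡⟨ T-cong (T-*ₗ 2ℚ (S (X ∘ suc))) n ⟩
    T (λ k → 2ℚ * T (S (X ∘ suc)) k) n        ≡⟨ T-*ₗ 2ℚ (T (S (X ∘ suc))) n ⟩
    2ℚ * T (T (S (X ∘ suc))) n                ∎

infix 4 _≗0<_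
_≗0<_ : (ℕ → ℚ) → ℕ → Set
X ≗0< n = ∀ k → k ℕ.< n → X k ≡ 0ℚ

-- The constant term of e^t is 1, so the lowest term of a series survives multiplication by e^t.
T-leading : ∀ n X → X ≗0< n → T X n ≡ X n
T-leading zero X X≗0 = refl
T-leading (suc n) X X≗0 = begin
  T X n + T (X ∘ suc) n ≡⟨ cong₂ _+_ (T-leading n X (λ k k<n → X≗0 k (ℕP.m<n⇒m<1+n k<n)))
                                     (T-leading n (X ∘ suc) (λ k k<n → X≗0 (suc k) (s≤s k<n))) ⟩
  X n + X (suc n)       ≡⟨ cong (_+ X (suc n)) (X≗0 n ℕP.≤-refl) ⟩
  0ℚ + X (suc n)        ≡⟨ ℚP.+-identityˡ (X (suc n)) ⟩
  X (suc n)             ∎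

-- One degree above the lowest, the term t of e^t also contributes: t · t^n/n! = (n+1) ·
-- t^(n+1)/(n+1)!.
T-subleading : ∀ n X → X ≗0< n → T X (suc n) ≡ X (suc n) + natℚ (suc n) * X n
T-subleading zero X X≗0 =
  solve 2 (λ a b → a :+ b := b :+ con 1ℚ :* a) refl (X 0) (X 1)
T-subleading (suc m) X X≗0 = begin
  T X (suc m) + T (X ∘ suc) (suc m)
    ≡⟨ cong₂ _+_ (T-leading (suc m) X X≗0)
                 (T-subleading m (X ∘ suc) (λ k k<m → X≗0 (suc k) (s≤s k<m))) ⟩
  X (suc m) + (X (suc (suc m)) + natℚ (suc m) * X (suc m))
    ≡⟨ solve 3 (λ a b c → a :+ (b :+ c :* a) := b :+ (con 1ℚ :+ c) :* a) refl
         (X (suc m)) (X (suc (suc m))) (natℚ (suc m)) ⟩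
  X (suc (suc m)) + (1ℚ + natℚ (suc m)) * X (suc m)
    ≡⟨ cong (λ c → X (suc (suc m)) + c * X (suc m)) (sym (natℚ-+ 1 (suc m))) ⟩
  X (suc (suc m)) + natℚ (suc (suc m)) * X (suc m) ∎

natℚ-suc-nonZero : ∀ n → ℚ.NonZero (natℚ (suc n))
natℚ-suc-nonZero n rewrite natℚ-coprime (suc n) = _

natℚ-suc-cancel : ∀ n x → natℚ (suc n) * x ≡ 0ℚ → x ≡ 0ℚ
natℚ-suc-cancel n x cx≡0 = begin
  x              ≡⟨ sym (ℚP.*-identityˡ x) ⟩
  1ℚ * x         ≡⟨ cong (_* x) (sym (ℚP.*-inverseˡ c)) ⟩
  ℚ.1/ c * c * x ≡⟨ ℚP.*-assoc (ℚ.1/ c) c x ⟩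
  ℚ.1/ c * (c * x) ≡⟨ cong (ℚ.1/ c *_) cx≡0 ⟩
  ℚ.1/ c * 0ℚ    ≡⟨ ℚP.*-zeroʳ (ℚ.1/ c) ⟩
  0ℚ             ∎
  where
  c = natℚ (suc n)
  instance c≢0 = natℚ-suc-nonZero n

-- e^{2t} − 1 = 2t + ⋯ is not a zero divisor: the first nonzero coefficient X m would give
-- 2 (m+1) X m in degree m+1.
T²-fixed⇒0 : ∀ X → (∀ n → T (T X) n ≡ X n) → ∀ n → X n ≡ 0ℚ
T²-fixed⇒0 X T²X≗X n = below (suc n) n ℕP.≤-refl
  where
  vanish : ∀ m → X ≗0< m → X m ≡ 0ℚ
  -- Each of the two applications of `T` adds (m+1) X m in degree m+1, so fixedness leaves 2 (m+1) X
  -- m = 0. The outer cancellation at index 1 removes the factor 2.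
  vanish m X≗0 = natℚ-suc-cancel 1 (X m) (natℚ-suc-cancel m (natℚ 2 * X m) (begin
    natℚ (suc m) * (2ℚ * X m)
      ≡⟨ solve 3 (λ b c x → c :* (con 2ℚ :* x) := ((b :+ c :* x) :+ c :* x) :+ :- b) refl
           (X (suc m)) (natℚ (suc m)) (X m) ⟩
    ((X (suc m) + natℚ (suc m) * X m) + natℚ (suc m) * X m) + - X (suc m)
      ≡⟨ cong (_+ - X (suc m)) (sym T²X-suc) ⟩
    T (T X) (suc m) + - X (suc m)
      ≡⟨ cong (_+ - X (suc m)) (T²X≗X (suc m)) ⟩
    X (suc m) + - X (suc m)
      ≡⟨ ℚP.+-inverseʳ (X (suc m)) ⟩
    0ℚ ∎))
    where
    TX≗0 : T X ≗0< m
    TX≗0 k k<m = trans (T-leading k X (λ i i<k → X≗0 i (ℕP.<-trans i<k k<m))) (X≗0 k k<m)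
    T²X-suc : T (T X) (suc m) ≡ (X (suc m) + natℚ (suc m) * X m) + natℚ (suc m) * X m
    T²X-suc = trans (T-subleading m (T X) TX≗0)
      (cong₂ (λ a b → a + natℚ (suc m) * b) (T-subleading m X X≗0) (T-leading m X X≗0))
  below : ∀ m → X ≗0< m
  below (suc m) k k<1+m with ℕP.m<1+n⇒m<n∨m≡n k<1+m
  ... | inj₁ k<m = below m k k<m
  ... | inj₂ refl = vanish m (below m)

-- Binomial sums.

∑< : ℕ → (ℕ → ℚ) → ℚ
∑< zero f = 0ℚ
∑< (suc n) f = ∑< n f + f n

∑<-cong : ∀ n {f g} → (∀ k → f k ≡ g k) → ∑< n f ≡ ∑< n g
∑<-cong zero f≗g = refl
∑<-cong (suc n) f≗g = cong₂ _+_ (∑<-cong n f≗g) (f≗g n)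

∑<-+ : ∀ n f g → ∑< n (λ k → f k + g k) ≡ ∑< n f + ∑< n g
∑<-+ zero f g = refl
∑<-+ (suc n) f g = begin
  ∑< n (λ k → f k + g k) + (f n + g n) ≡⟨ cong (_+ (f n + g n)) (∑<-+ n f g) ⟩
  (∑< n f + ∑< n g) + (f n + g n)
    ≡⟨ solve 4 (λ a b c d → (a :+ b) :+ (c :+ d) := (a :+ c) :+ (b :+ d)) refl
         (∑< n f) (∑< n g) (f n) (g n) ⟩
  ∑< (suc n) f + ∑< (suc n) g ∎

∑<-head : ∀ n f → ∑< (suc n) f ≡ f 0 + ∑< n (f ∘ suc)
∑<-head zero f = ℚP.+-comm 0ℚ (f 0)
∑<-head (suc n) f = trans (cong (_+ f (suc n)) (∑<-head n f))
                          (ℚP.+-assoc (f 0) (∑< n (f ∘ suc)) (f (suc n)))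

nC0≡1 : ∀ n → n C 0 ≡ 1
nC0≡1 n = trans (nCk≡nC[n∸k] {0} {n} z≤n) (nCn≡1 n)

-- This links the derivative-style definition of `T` to the binomial convolution in the recursions
-- for `B` and `G`. The two sums from the induction hypothesis, shifted by one against each other,
-- merge by Pascal's rule.
T-∑< : ∀ n X → T X n ≡ ∑< (suc n) (λ k → natℚ (n C k) * X k)
T-∑< zero X = solve 1 (λ x → x := con 0ℚ :+ con 1ℚ :* x) refl (X 0)
T-∑< (suc n) X = begin
  T X n + T (X ∘ suc) n
    ≡⟨ cong₂ _+_ (T-∑< n X) (T-∑< n (X ∘ suc)) ⟩
  ∑< (suc n) f + ∑< (suc n) g
    ≡⟨ cong (_+ ∑< (suc n) g) extend ⟩
  ∑< (suc (suc n)) f + ∑< (suc n) g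
    ≡⟨ cong (_+ ∑< (suc n) g) (∑<-head (suc n) f) ⟩
  (f 0 + ∑< (suc n) (f ∘ suc)) + ∑< (suc n) g
    ≡⟨ ℚP.+-assoc (f 0) (∑< (suc n) (f ∘ suc)) (∑< (suc n) g) ⟩
  f 0 + (∑< (suc n) (f ∘ suc) + ∑< (suc n) g)
    ≡⟨ cong₂ _+_ (cong (λ c → natℚ c * X 0) (trans (nC0≡1 n) (sym (nC0≡1 (suc n)))))
                 (trans (sym (∑<-+ (suc n) (f ∘ suc) g)) (∑<-cong (suc n) pascal)) ⟩
  h 0 + ∑< (suc n) (h ∘ suc)
    ≡⟨ sym (∑<-head (suc n) h) ⟩
  ∑< (suc (suc n)) h ∎
  where
  f g h : ℕ → ℚ
  f k = natℚ (n C k) * X k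
  g k = natℚ (n C k) * X (suc k)
  h k = natℚ (suc n C k) * X k
  -- A zero term, C(n, n+1) = 0, is appended so that splitting off the head leaves a sum of the same
  -- length as that of `g`.
  extend : ∑< (suc n) f ≡ ∑< (suc (suc n)) f
  extend = begin
    ∑< (suc n) f                    ≡⟨ solve 2 (λ s x → s := s :+ con 0ℚ :* x) refl (∑< (suc n) f) (X (suc n)) ⟩
    ∑< (suc n) f + 0ℚ * X (suc n)   ≡⟨ cong (λ c → ∑< (suc n) f + natℚ c * X (suc n)) (sym (k>n⇒nCk≡0 (ℕP.n<1+n n))) ⟩
    ∑< (suc (suc n)) f              ∎
  pascal : ∀ k → f (suc k) + g k ≡ h (suc k)
  pascal k = begin
    natℚ (n C suc k) * X (suc k) + natℚ (n C k) * X (suc k)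
      ≡⟨ solve 3 (λ a b x → a :* x :+ b :* x := (b :+ a) :* x) refl (natℚ (n C suc k)) (natℚ (n C k)) (X (suc k)) ⟩
    (natℚ (n C k) + natℚ (n C suc k)) * X (suc k)
      ≡⟨ cong (_* X (suc k)) (sym (natℚ-+ (n C k) (n C suc k))) ⟩
    natℚ (n C k ℕ.+ n C suc k) * X (suc k)
      ≡⟨ cong (λ c → natℚ c * X (suc k)) (nCk+nC[k+1]≡[n+1]C[k+1] n k) ⟩
    h (suc k) ∎

-- Recursions and functional equations of `B` and `G`.

wsumFrom-∷ʳ : ∀ i w xs x → wsumFrom i w (xs ++ [ x ]) ≡ wsumFrom i w xs + w (i ℕ.+ length xs) * x
wsumFrom-∷ʳ i w [] x rewrite ℕP.+-identityʳ i = ℚP.+-comm (w i * x) 0ℚ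
wsumFrom-∷ʳ i w (y ∷ xs) x rewrite ℕP.+-suc i (length xs) =
  trans (cong (λ s → w i * y + s) (wsumFrom-∷ʳ (suc i) w xs x))
        (sym (ℚP.+-assoc (w i * y) (wsumFrom (suc i) w xs) _))

length-prefix : ∀ f n → length (prefix f n) ≡ n
length-prefix f zero = refl
length-prefix f (suc n) = trans (length-++ (prefix f n))
  (trans (ℕP.+-comm _ 1) (cong suc (length-prefix f n)))

wsum-prefix : ∀ f w n → wsum w (prefix f n) ≡ ∑< n (λ k → w k * f k (prefix f k))
wsum-prefix f w zero = refl
wsum-prefix f w (suc n) = trans (wsumFrom-∷ʳ 0 w (prefix f n) _)
  (cong₂ _+_ (wsum-prefix f w n) (cong (λ i → w i * f n (prefix f n)) (length-prefix f n)))

-- `B` unfolds definitionally to one recursion step, so only its list sum has to be rewritten as a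
-- sum over indices.
B-rec : ∀ n → B n ≡ (ℤ.+ 1 ℚ./ suc n) * (δ n 0 + - ∑< n (λ k → natℚ (suc n C k) * B k))
B-rec n = cong (λ s → (ℤ.+ 1 ℚ./ suc n) * (δ n 0 + - s)) (wsum-prefix bernStep _ n)

G-rec : ∀ n → G n ≡ (ℤ.+ 1 ℚ./ 2) * (2ℚ * δ n 1 + - ∑< n (λ k → natℚ (n C k) * G k))
G-rec n = cong (λ s → (ℤ.+ 1 ℚ./ 2) * (2ℚ * δ n 1 + - s)) (wsum-prefix genStep _ n)

-- The exponential generating function of this sequence is the variable t itself.
t : ℕ → ℚ
t n = δ n 1

[1+n]Cn≡1+n : ∀ n → suc n C n ≡ suc n
[1+n]Cn≡1+n n = trans (nCk≡nC[n∸k] (ℕP.n≤1+n n))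
  (trans (cong (suc n C_) (ℕP.m+n∸n≡m 1 n)) (nC1≡n (suc n)))

natℚ-recip : ∀ n → natℚ (suc n) * (ℤ.+ 1 ℚ./ suc n) ≡ 1ℚ
natℚ-recip n = trans (cong (natℚ (suc n) *_) (ℚP.normalize-coprime (Coprimality.1-coprimeTo (suc n)))) lem
  where
  lem : natℚ (suc n) * mkℚ (ℤ.+ 1) n (Coprimality.1-coprimeTo (suc n)) ≡ 1ℚ
  lem rewrite natℚ-coprime (suc n) = ℚP.*-inverseʳ (mkℚ (ℤ.+ suc n) 0 (Coprimality.sym (Coprimality.1-coprimeTo (suc n))))

-- Coefficientwise form of e^t B(t) = B(t) + t, the defining equation of the Bernoulli numbers.
T-B : ∀ n → T B n ≡ B n + t n
T-B zero = sym (ℚP.+-identityʳ (B 0))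
T-B (suc n) = begin
  T B (suc n)
    ≡⟨ T-∑< (suc n) B ⟩
  (∑< n f + natℚ (suc n C n) * B n) + natℚ (suc n C suc n) * B (suc n)
    ≡⟨ cong₂ (λ c d → (∑< n f + natℚ c * B n) + natℚ d * B (suc n)) ([1+n]Cn≡1+n n) (nCn≡1 (suc n)) ⟩
  (∑< n f + natℚ (suc n) * B n) + 1ℚ * B (suc n)
    -- The recursion at n concerns degree n+1: substituting it for `B n`, whose weight is n+1,
    -- cancels all earlier terms and leaves δ n 0.
    ≡⟨ cong (λ b → (∑< n f + natℚ (suc n) * b) + 1ℚ * B (suc n)) (B-rec n) ⟩
  (∑< n f + natℚ (suc n) * ((ℤ.+ 1 ℚ./ suc n) * (δ n 0 + - ∑< n f))) + 1ℚ * B (suc n)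
    ≡⟨ solve 5 (λ s c r d b → (s :+ c :* (r :* (d :+ :- s))) :+ con 1ℚ :* b
                 := b :+ (s :+ (c :* r) :* (d :+ :- s))) refl
         (∑< n f) (natℚ (suc n)) (ℤ.+ 1 ℚ./ suc n) (δ n 0) (B (suc n)) ⟩
  B (suc n) + (∑< n f + (natℚ (suc n) * (ℤ.+ 1 ℚ./ suc n)) * (δ n 0 + - ∑< n f))
    ≡⟨ cong (λ c → B (suc n) + (∑< n f + c * (δ n 0 + - ∑< n f))) (natℚ-recip n) ⟩
  B (suc n) + (∑< n f + 1ℚ * (δ n 0 + - ∑< n f))
    ≡⟨ solve 3 (λ b s d → b :+ (s :+ con 1ℚ :* (d :+ :- s)) := b :+ d) refl (B (suc n)) (∑< n f) (δ n 0) ⟩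
  B (suc n) + δ n 0
    ≡⟨ cong (B (suc n) +_) (δ-suc n) ⟩
  B (suc n) + t (suc n) ∎
  where
  f : ℕ → ℚ
  f k = natℚ (suc n C k) * B k
  δ-suc : ∀ n → δ n 0 ≡ δ (suc n) 1
  δ-suc zero = refl
  δ-suc (suc n) = refl

-- Coefficientwise form of e^t G(t) = 2t - G(t). The top binomial term C(n,n) G n joins the G n on
-- the right, which explains the factor 1/2 in the recursion.
T-G : ∀ n → T G n ≡ 2ℚ * t n + - G n
T-G n = begin
  T G n
    ≡⟨ T-∑< n G ⟩
  s + natℚ (n C n) * G n
    ≡⟨ cong (λ c → s + natℚ c * G n) (nCn≡1 n) ⟩
  s + 1ℚ * G n
    ≡⟨ solve 2 (λ s g → s :+ con 1ℚ :* g := (s :+ con 2ℚ :* g) :+ :- g) refl s (G n) ⟩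
  (s + 2ℚ * G n) + - G n
    ≡⟨ cong (λ g → (s + 2ℚ * g) + - G n) (G-rec n) ⟩
  (s + 2ℚ * ((ℤ.+ 1 ℚ./ 2) * (2ℚ * t n + - s))) + - G n
    ≡⟨ solve 3 (λ s d g → (s :+ con 2ℚ :* (con (ℤ.+ 1 ℚ./ 2) :* (con 2ℚ :* d :+ :- s))) :+ :- g
                 := con 2ℚ :* d :+ :- g) refl s (t n) (G n) ⟩
  2ℚ * t n + - G n ∎
  where
  s = ∑< n (λ k → natℚ (n C k) * G k)

-- The relation between Genocchi and Bernoulli numbers.

-1ℚ : ℚ
-1ℚ = - 1ℚ

T-linear : ∀ a b X Y n → T (λ k → a * X k + b * Y k) n ≡ a * T X n + b * T Y n
T-linear a b X Y n = trans (T-+ (λ k → a * X k) (λ k → b * Y k) n) (cong₂ _+_ (T-*ₗ a X n) (T-*ₗ b Y n))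

T²-linear : ∀ a b X Y n → T (T (λ k → a * X k + b * Y k)) n ≡ a * T (T X) n + b * T (T Y) n
T²-linear a b X Y n = trans (T-cong (T-linear a b X Y) n) (T-linear a b (T X) (T Y) n)

T²-B : ∀ n → T (T B) n ≡ (B n + t n) + T t n
T²-B n = begin
  T (T B) n             ≡⟨ T-cong T-B n ⟩
  T (λ k → B k + t k) n ≡⟨ T-+ B t n ⟩
  T B n + T t n         ≡⟨ cong (_+ T t n) (T-B n) ⟩
  (B n + t n) + T t n   ∎

S-t : ∀ n → S t n ≡ 2ℚ * t n
S-t 0 = refl
S-t 1 = refl
S-t (suc (suc n)) = ℚP.*-zeroʳ (natℚ (2 ℕ.^ suc (suc n)))

-- The equation for B(t) with 2t substituted for t.
T²-SB : ∀ n → T (T (S B)) n ≡ S B n + 2ℚ * t n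
T²-SB n = begin
  T (T (S B)) n                   ≡⟨ T²-scale B n ⟩
  natℚ (2 ℕ.^ n) * T B n          ≡⟨ cong (natℚ (2 ℕ.^ n) *_) (T-B n) ⟩
  natℚ (2 ℕ.^ n) * (B n + t n)    ≡⟨ ℚP.*-distribˡ-+ (natℚ (2 ℕ.^ n)) (B n) (t n) ⟩
  S B n + S t n                   ≡⟨ cong (λ x → S B n + x) (S-t n) ⟩
  S B n + 2ℚ * t n                ∎

-- Multiplying e^t G = 2t - G by e^t once more gives (e^(2t) - 1) G = 2t (e^t - 1).
T²-G : ∀ n → T (T G) n ≡ 2ℚ * T t n + - (2ℚ * t n + - G n)
T²-G n = begin
  T (T G) n                              ≡⟨ T-cong (λ k → trans (T-G k) (neg k)) n ⟩
  T (λ k → 2ℚ * t k + -1ℚ * G k) n       ≡⟨ T-linear 2ℚ -1ℚ t G n ⟩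
  2ℚ * T t n + -1ℚ * T G n               ≡⟨ cong (λ x → 2ℚ * T t n + -1ℚ * x) (T-G n) ⟩
  2ℚ * T t n + -1ℚ * (2ℚ * t n + - G n)
    ≡⟨ solve 2 (λ a b → a :+ con -1ℚ :* b := a :+ :- b) refl (2ℚ * T t n) (2ℚ * t n + - G n) ⟩
  2ℚ * T t n + - (2ℚ * t n + - G n)      ∎
  where
  neg : ∀ k → 2ℚ * t k + - G k ≡ 2ℚ * t k + -1ℚ * G k
  neg k = solve 2 (λ a b → a :+ :- b := a :+ con -1ℚ :* b) refl (2ℚ * t k) (G k)

genocchi-bernoulli : ∀ n → G n ≡ 2ℚ * (B n + - S B n)
genocchi-bernoulli n = begin
  G n
    ≡⟨ solve 3 (λ b s g → g := con 2ℚ :* (b :+ :- s)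
                 :+ :- (con 2ℚ :* (con 1ℚ :* b :+ con -1ℚ :* s) :+ con -1ℚ :* g)) refl (B n) (S B n) (G n) ⟩
  2ℚ * (B n + - S B n) + - X n
    ≡⟨ cong (λ x → 2ℚ * (B n + - S B n) + - x) (T²-fixed⇒0 X T²X≗X n) ⟩
  2ℚ * (B n + - S B n) + 0ℚ
    ≡⟨ ℚP.+-identityʳ _ ⟩
  2ℚ * (B n + - S B n) ∎
  where
  X : ℕ → ℚ
  -- The difference 2 (B(t) - B(2t)) - G(t), with coefficients 1 and -1 written out so that
  -- `T²-linear` applies to it.
  X k = 2ℚ * (1ℚ * B k + -1ℚ * S B k) + -1ℚ * G k
  T²X≗X : ∀ k → T (T X) k ≡ X k
  T²X≗X k = begin
    T (T X) k
      ≡⟨ T²-linear 2ℚ -1ℚ (λ i → 1ℚ * B i + -1ℚ * S B i) G k ⟩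
    2ℚ * T (T (λ i → 1ℚ * B i + -1ℚ * S B i)) k + -1ℚ * T (T G) k
      ≡⟨ cong (λ x → 2ℚ * x + -1ℚ * T (T G) k) (T²-linear 1ℚ -1ℚ B (S B) k) ⟩
    2ℚ * (1ℚ * T (T B) k + -1ℚ * T (T (S B)) k) + -1ℚ * T (T G) k
      ≡⟨ cong₂ (λ x y → 2ℚ * (1ℚ * x + -1ℚ * y) + -1ℚ * T (T G) k) (T²-B k) (T²-SB k) ⟩
    2ℚ * (1ℚ * ((B k + t k) + T t k) + -1ℚ * (S B k + 2ℚ * t k)) + -1ℚ * T (T G) k
      ≡⟨ cong (λ x → 2ℚ * (1ℚ * ((B k + t k) + T t k) + -1ℚ * (S B k + 2ℚ * t k)) + -1ℚ * x) (T²-G k) ⟩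
    2ℚ * (1ℚ * ((B k + t k) + T t k) + -1ℚ * (S B k + 2ℚ * t k)) + -1ℚ * (2ℚ * T t k + - (2ℚ * t k + - G k))
      -- The inhomogeneous terms cancel: 2 (t + t e^t - 2t) from the Bernoulli side equals 2t e^t -
      -- 2t from the Genocchi side.
      ≡⟨ solve 5 (λ b s g t u →
           con 2ℚ :* (con 1ℚ :* ((b :+ t) :+ u) :+ con -1ℚ :* (s :+ con 2ℚ :* t))
             :+ con -1ℚ :* (con 2ℚ :* u :+ :- (con 2ℚ :* t :+ :- g))
           := con 2ℚ :* (con 1ℚ :* b :+ con -1ℚ :* s) :+ con -1ℚ :* g) refl
           (B k) (S B k) (G k) (t k) (T t k) ⟩
    X k ∎

-- The sign of 1 - 4^j is moved onto the Bernoulli number, so that the other factor is a natural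
-- number.
genocchi-even : ∀ j → G (2 ℕ.* j) ≡ natℚ (2 ℕ.* (4 ℕ.^ j ∸ 1)) * - B (2 ℕ.* j)
genocchi-even j = begin
  G n                                            ≡⟨ genocchi-bernoulli n ⟩
  2ℚ * (B n + - (natℚ (2 ℕ.^ n) * B n))          ≡⟨ cong (λ c → 2ℚ * (B n + - (c * B n))) power ⟩
  2ℚ * (B n + - ((1ℚ + natℚ c) * B n))
    ≡⟨ solve 2 (λ b c → con 2ℚ :* (b :+ :- ((con 1ℚ :+ c) :* b)) := (con 2ℚ :* c) :* :- b) refl (B n) (natℚ c) ⟩
  (2ℚ * natℚ c) * - B n                          ≡⟨ cong (_* - B n) (sym (natℚ-* 2 c)) ⟩
  natℚ (2 ℕ.* c) * - B n                         ∎
  where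
  n = 2 ℕ.* j
  c = 4 ℕ.^ j ∸ 1
  power : natℚ (2 ℕ.^ n) ≡ 1ℚ + natℚ c
  power = begin
    natℚ (2 ℕ.^ n)      ≡⟨ cong natℚ (sym (ℕP.^-*-assoc 2 2 j)) ⟩
    natℚ (4 ℕ.^ j)      ≡⟨ cong natℚ (sym (ℕP.m+[n∸m]≡n (ℕP.m^n>0 4 j))) ⟩
    natℚ (1 ℕ.+ c)      ≡⟨ natℚ-+ 1 c ⟩
    1ℚ + natℚ c         ∎

-- Numerators and denominators in lowest terms.

num den : ℚ → ℕ
num q = ℤ.∣ ↥ q ∣
den q = ↧ₙ q

abs-*-≡ : ∀ i g j k → i ℤ.* g ≡ j ℤ.* k → ℤ.∣ i ∣ ℕ.* ℤ.∣ g ∣ ≡ ℤ.∣ j ∣ ℕ.* ℤ.∣ k ∣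
abs-*-≡ i g j k eq = trans (sym (ℤP.abs-* i g)) (trans (cong ℤ.∣_∣ eq) (ℤP.abs-* j k))

-- The witness g is the common factor cancelled when the product of the two fractions is reduced.
*-reduction : ∀ a b → ∃ λ g → (num (a * b) ℕ.* g ≡ num a ℕ.* num b) × (den (a * b) ℕ.* g ≡ den a ℕ.* den b)
*-reduction a b = ℤ.∣ g ∣ , abs-*-≡ (↥ (a * b)) g (↥ a) (↥ b) (ℚP.↥-* a b)
                          , abs-*-≡ (↧ (a * b)) g (↧ a) (↧ b) (ℚP.↧-* a b)
  where g = ℤGCD.gcd (↥ a ℤ.* ↥ b) (↧ a ℤ.* ↧ b)

den-+ : ∀ a b → den (a + b) ∣ den a ℕ.* den b
den-+ a b = divides ℤ.∣ g ∣ (trans (sym (abs-*-≡ (↧ (a + b)) g (↧ a) (↧ b) (ℚP.↧-+ a b)))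
                                   (ℕP.*-comm (den (a + b)) ℤ.∣ g ∣))
  where g = ℤGCD.gcd (↥ a ℤ.* ↧ b ℤ.+ ↥ b ℤ.* ↧ a) (↧ a ℤ.* ↧ b)

den-* : ∀ a b → den (a * b) ∣ den a ℕ.* den b
den-* a b with *-reduction a b
... | g , _ , eq = subst (den (a * b) ∣_) eq (m∣m*n g)

den-neg : ∀ a → den (- a) ≡ den a
den-neg a = cong ℤ.∣_∣ (ℚP.↧-neg a)

num-neg : ∀ a → num (- a) ≡ num a
num-neg a = trans (cong ℤ.∣_∣ (ℚP.↥-neg a)) (ℤP.∣-i∣≡∣i∣ (↥ a))

num-natℚ : ∀ n → num (natℚ n) ≡ n
num-natℚ n = cong num (natℚ-coprime n)

den-natℚ : ∀ n → den (natℚ n) ≡ 1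
den-natℚ n = cong den (natℚ-coprime n)

den-recip : ∀ n → den (ℤ.+ 1 ℚ./ suc n) ≡ suc n
den-recip n = cong den (ℚP.normalize-coprime (Coprimality.1-coprimeTo (suc n)))

-- Binomial coefficients and row sums of Pascal's triangle.

-- For n + 1 = p this shows p divides (k+1) C(p, k+1). Induction by Pascal's rule, after setting one
-- copy of C(n+1, k+1) aside.
binomial-absorption : ∀ n k → suc k ℕ.* (suc n C suc k) ≡ suc n ℕ.* (n C k)
binomial-absorption zero zero = refl
binomial-absorption zero (suc k) = begin
  suc (suc k) ℕ.* (1 C suc (suc k)) ≡⟨ cong (suc (suc k) ℕ.*_) (k>n⇒nCk≡0 {1} {suc (suc k)} (s≤s (s≤s z≤n))) ⟩
  suc (suc k) ℕ.* 0                 ≡⟨ ℕP.*-zeroʳ (suc (suc k)) ⟩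
  1 ℕ.* 0                           ≡⟨ cong (1 ℕ.*_) (sym (k>n⇒nCk≡0 {0} {suc k} (s≤s z≤n))) ⟩
  1 ℕ.* (0 C suc k)                 ∎
binomial-absorption (suc n) zero = begin
  1 ℕ.* (suc (suc n) C 1)   ≡⟨ cong (1 ℕ.*_) (nC1≡n (suc (suc n))) ⟩
  1 ℕ.* suc (suc n)         ≡⟨ ℕP.*-comm 1 (suc (suc n)) ⟩
  suc (suc n) ℕ.* 1         ≡⟨ cong (suc (suc n) ℕ.*_) (sym (nC0≡1 (suc n))) ⟩
  suc (suc n) ℕ.* (suc n C 0) ∎
binomial-absorption (suc n) (suc k) = begin
  suc (suc k) ℕ.* (suc (suc n) C suc (suc k))
    ≡⟨ cong (suc (suc k) ℕ.*_) (sym (nCk+nC[k+1]≡[n+1]C[k+1] (suc n) (suc k))) ⟩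
  suc (suc k) ℕ.* (c ℕ.+ (suc n C suc (suc k)))
    ≡⟨ expand k c (suc n C suc (suc k)) ⟩
  c ℕ.+ (suc k ℕ.* c ℕ.+ suc (suc k) ℕ.* (suc n C suc (suc k)))
    ≡⟨ cong (c ℕ.+_) (cong₂ ℕ._+_ (binomial-absorption n k) (binomial-absorption n (suc k))) ⟩
  c ℕ.+ (suc n ℕ.* (n C k) ℕ.+ suc n ℕ.* (n C suc k))
    ≡⟨ cong (c ℕ.+_) (sym (ℕP.*-distribˡ-+ (suc n) (n C k) (n C suc k))) ⟩
  c ℕ.+ suc n ℕ.* ((n C k) ℕ.+ (n C suc k))
    ≡⟨ cong (λ x → c ℕ.+ suc n ℕ.* x) (nCk+nC[k+1]≡[n+1]C[k+1] n k) ⟩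
  suc (suc n) ℕ.* c ∎
  where
  c = suc n C suc k
  expand : ∀ k c d → suc (suc k) ℕ.* (c ℕ.+ d) ≡ c ℕ.+ (suc k ℕ.* c ℕ.+ suc (suc k) ℕ.* d)
  expand = solve-∀

-- Rows are cut off at m so that `rowSum-mod` can build its congruence one entry at a time.
rowSum : ℕ → ℕ → ℕ
rowSum n zero = 0
rowSum n (suc m) = rowSum n m ℕ.+ n C m

-- By Pascal's rule each entry feeds two neighbours in the next row; the last entry before the
-- cut-off feeds only one of those kept.
rowSum-suc : ∀ n m → rowSum (suc n) (suc m) ≡ rowSum n (suc m) ℕ.+ rowSum n m
rowSum-suc n zero = begin
  0 ℕ.+ (suc n C 0)         ≡⟨ trans (nC0≡1 (suc n)) (sym (nC0≡1 n)) ⟩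
  n C 0                     ≡⟨ sym (ℕP.+-identityʳ (n C 0)) ⟩
  (n C 0) ℕ.+ 0             ∎
rowSum-suc n (suc m) = begin
  rowSum (suc n) (suc m) ℕ.+ (suc n C suc m)
    ≡⟨ cong₂ ℕ._+_ (rowSum-suc n m) (sym (nCk+nC[k+1]≡[n+1]C[k+1] n m)) ⟩
  (rowSum n (suc m) ℕ.+ rowSum n m) ℕ.+ ((n C m) ℕ.+ (n C suc m))
    ≡⟨ rearrange (rowSum n (suc m)) (rowSum n m) (n C m) (n C suc m) ⟩
  (rowSum n (suc m) ℕ.+ (n C suc m)) ℕ.+ rowSum n (suc m) ∎
  where
  rearrange : ∀ a b c d → (a ℕ.+ b) ℕ.+ (c ℕ.+ d) ≡ (a ℕ.+ d) ℕ.+ (b ℕ.+ c)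
  rearrange = solve-∀

rowSum-full : ∀ n → rowSum n (suc n) ≡ 2 ℕ.^ n
rowSum-full zero = refl
rowSum-full (suc n) = begin
  rowSum (suc n) (suc (suc n))
    ≡⟨ rowSum-suc n (suc n) ⟩
  (rowSum n (suc n) ℕ.+ (n C suc n)) ℕ.+ rowSum n (suc n)
    ≡⟨ cong (λ c → (rowSum n (suc n) ℕ.+ c) ℕ.+ rowSum n (suc n)) (k>n⇒nCk≡0 (ℕP.n<1+n n)) ⟩
  (rowSum n (suc n) ℕ.+ 0) ℕ.+ rowSum n (suc n)
    ≡⟨ cong (λ r → (r ℕ.+ 0) ℕ.+ r) (rowSum-full n) ⟩
  (2 ℕ.^ n ℕ.+ 0) ℕ.+ 2 ℕ.^ n
    ≡⟨ ℕP.+-comm (2 ℕ.^ n ℕ.+ 0) (2 ℕ.^ n) ⟩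
  2 ℕ.^ suc n ∎

-- Fermat's theorem for base 2.

module _ {p : ℕ} (pr : Prime p) where

  p∤1 : p ∤ 1
  p∤1 p∣1 = ¬prime[1] (subst Prime (∣1⇒≡1 p∣1) pr)

  ∤-small : ∀ {k} → suc k ℕ.< p → p ∤ suc k
  ∤-small k<p p∣k = ℕP.<⇒≱ k<p (∣⇒≤ p∣k)

  ∤2 : p ≢ 2 → p ∤ 2
  ∤2 p≢2 p∣2 with prime⇒irreducible prime[2] p∣2
  ... | inj₁ p≡1 = ¬prime[1] (subst Prime p≡1 pr)
  ... | inj₂ p≡2 = p≢2 p≡2

  prime∣binomial : ∀ {k} → suc k ℕ.< p → p ∣ p C suc k
  prime∣binomial {k} k<p = [ ⊥-elim ∘ ∤-small k<p , id ]′
    (euclidsLemma (suc k) (p C suc k) pr (absorb p refl))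
    where
    -- Absorption needs p in the form q + 1; matching on an auxiliary number equal to p provides it.
    absorb : ∀ q → q ≡ p → p ∣ suc k ℕ.* (p C suc k)
    absorb zero refl = ⊥-elim (ℕP.n≮0 k<p)
    absorb (suc q) refl = subst (p ∣_) (sym (binomial-absorption q k)) (m∣m*n (q C k))

  -- The inner entries C(p,1), ..., C(p,m) all vanish modulo p. The congruence to 1 is stated with a
  -- witness, which avoids truncated subtraction.
  rowSum-mod : ∀ m → m ℕ.< p → ∃ λ x → (rowSum p (suc m) ≡ 1 ℕ.+ x) × p ∣ x
  rowSum-mod zero _ = 0 , nC0≡1 p , p ∣0
  rowSum-mod (suc m) m<p with rowSum-mod m (ℕP.<-trans (ℕP.n<1+n m) m<p)
  ... | x , eq , p∣x = x ℕ.+ (p C suc m) , cong (ℕ._+ (p C suc m)) eq , ∣m∣n⇒∣m+n p∣x (prime∣binomial m<p)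

  -- Expanding 2^p = (1+1)^p, only the two outer entries survive modulo p. Hence p divides 2^p - 2 =
  -- 2 (2^(p-1) - 1), and the factor 2 cancels as p is odd.
  fermat₂ : p ≢ 2 → ∀ q → p ≡ suc q → p ∣ 2 ℕ.^ q ∸ 1
  fermat₂ p≢2 q refl with rowSum-mod q ℕP.≤-refl
  ... | x , eq , p∣x = [ ⊥-elim ∘ ∤2 p≢2 , id ]′
        (euclidsLemma 2 (2 ℕ.^ q ∸ 1) pr (subst (p ∣_) (sym total) p∣x))
    where
    total : 2 ℕ.* (2 ℕ.^ q ∸ 1) ≡ x
    total = begin
      2 ℕ.* (2 ℕ.^ q ∸ 1)          ≡⟨ ℕP.*-distribˡ-∸ 2 (2 ℕ.^ q) 1 ⟩
      2 ℕ.^ p ∸ 2                  ≡⟨ cong (_∸ 2) (sym (rowSum-full p)) ⟩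
      rowSum p p ℕ.+ (p C p) ∸ 2   ≡⟨ cong (_∸ 2) (cong₂ ℕ._+_ eq (nCn≡1 p)) ⟩
      (1 ℕ.+ x) ℕ.+ 1 ∸ 2          ≡⟨ cong (_∸ 2) (ℕP.+-comm (1 ℕ.+ x) 1) ⟩
      x                            ∎

  -- Divisibility by p and p-integrality of rationals.

  ∣num-* : ∀ a b → p ∣ num (a * b) → p ∣ num a ⊎ p ∣ num b
  ∣num-* a b p∣ab with *-reduction a b
  ... | g , eq , _ = euclidsLemma (num a) (num b) pr (subst (p ∣_) eq (∣m⇒∣m*n g p∣ab))

  -- If reduction cancelled the factor p, then p would divide the product of the denominators, hence
  -- one of them.
  num-*-∣ : ∀ a b → p ∣ num a ℕ.* num b → p ∤ den a → p ∤ den b → p ∣ num (a * b)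
  num-*-∣ a b p∣nn p∤a p∤b with *-reduction a b
  ... | g , eqn , eqd with euclidsLemma (num (a * b)) g pr (subst (p ∣_) (sym eqn) p∣nn)
  ... | inj₁ p∣ab = p∣ab
  ... | inj₂ p∣g = ⊥-elim ([ p∤a , p∤b ]′ (euclidsLemma (den a) (den b) pr (subst (p ∣_) eqd (∣n⇒∣m*n (den (a * b)) p∣g))))

  Integral : ℚ → Set
  Integral q = p ∤ den q

  integral-+ : ∀ {a b} → Integral a → Integral b → Integral (a + b)
  integral-+ {a} {b} ia ib d = [ ia , ib ]′ (euclidsLemma (den a) (den b) pr (∣-trans d (den-+ a b)))

  integral-* : ∀ {a b} → Integral a → Integral b → Integral (a * b)
  integral-* {a} {b} ia ib d = [ ia , ib ]′ (euclidsLemma (den a) (den b) pr (∣-trans d (den-* a b)))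

  integral-neg : ∀ {a} → Integral a → Integral (- a)
  integral-neg {a} ia = ia ∘ subst (p ∣_) (den-neg a)

  integral-natℚ : ∀ n → Integral (natℚ n)
  integral-natℚ n = p∤1 ∘ subst (p ∣_) (den-natℚ n)

  integral-recip : ∀ n → suc n ℕ.< p → Integral (ℤ.+ 1 ℚ./ suc n)
  integral-recip n n<p = ∤-small n<p ∘ subst (p ∣_) (den-recip n)

  integral-δ : ∀ m n → Integral (δ m n)
  integral-δ m n with m ℕ.≟ n
  ... | yes _ = p∤1
  ... | no _ = p∤1

  integral-∑< : ∀ n f → (∀ k → k ℕ.< n → Integral (f k)) → Integral (∑< n f)
  integral-∑< zero f i = p∤1
  integral-∑< (suc n) f i = integral-+ {∑< n f} {f n}
    (integral-∑< n f (λ k k<n → i k (ℕP.m<n⇒m<1+n k<n))) (i n ℕP.≤-refl)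

  -- Strong induction, made structural by the bound m: the recursion for `B n` divides only by n + 1
  -- ≤ m < p and refers to smaller indices.
  integral-B< : ∀ m → m ℕ.< p → ∀ n → n ℕ.< m → Integral (B n)
  integral-B< (suc m) m<p n n≤m = subst Integral (sym (B-rec n))
    (integral-* {ℤ.+ 1 ℚ./ suc n} {δ n 0 + - s} (integral-recip n (ℕP.≤-<-trans n≤m m<p))
      (integral-+ {δ n 0} { - s} (integral-δ n 0) (integral-neg {s} (integral-∑< n f terms))))
    where
    f : ℕ → ℚ
    f k = natℚ (suc n C k) * B k
    s = ∑< n f
    terms : ∀ k → k ℕ.< n → Integral (f k)
    terms k k<n = integral-* {natℚ (suc n C k)} {B k} (integral-natℚ (suc n C k))
      (integral-B< m (ℕP.<-trans (ℕP.n<1+n m) m<p) k (ℕP.<-≤-trans k<n (ℕP.≤-pred n≤m)))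

  integral-B : ∀ n → suc n ℕ.< p → Integral (B n)
  integral-B n n<p = integral-B< (suc n) n<p n ℕP.≤-refl

  -- Oddness of p discards the factor 2. Integrality of b serves the converse, where a p in the
  -- denominator of b could otherwise cancel the one dividing c.
  ∣num-scaled : p ≢ 2 → ∀ c q b → q ≡ natℚ (2 ℕ.* c) * - b → Integral b →
                (p ∣num q) ⇔ (p ∣ c ⊎ p ∣num b)
  ∣num-scaled p≢2 c q b q≡ ib = mk⇔ to from
    where
    to : p ∣num q → p ∣ c ⊎ p ∣num b
    to p∣q with ∣num-* (natℚ (2 ℕ.* c)) (- b) (subst (λ x → p ∣num x) q≡ p∣q)
    ... | inj₁ p∣2c = inj₁ ([ ⊥-elim ∘ ∤2 p≢2 , id ]′ (euclidsLemma 2 c pr (subst (p ∣_) (num-natℚ (2 ℕ.* c)) p∣2c)))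
    ... | inj₂ p∣b = inj₂ (subst (p ∣_) (num-neg b) p∣b)
    from : p ∣ c ⊎ p ∣num b → p ∣num q
    from d = subst (λ x → p ∣num x) (sym q≡)
      (num-*-∣ (natℚ (2 ℕ.* c)) (- b)
        (subst (p ∣_) (sym (cong₂ ℕ._*_ (num-natℚ (2 ℕ.* c)) (num-neg b)))
          ([ ∣m⇒∣m*n (num b) ∘ ∣n⇒∣m*n 2 , ∣n⇒∣m*n (2 ℕ.* c) ]′ d))
        (integral-natℚ (2 ℕ.* c)) (integral-neg {b} ib))

  ∣genocchi : p ≢ 2 → ∀ j → suc (2 ℕ.* j) ℕ.< p →
              (p ∣num G (2 ℕ.* j)) ⇔ (p ∣ 4 ℕ.^ j ∸ 1 ⊎ p ∣num B (2 ℕ.* j))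
  ∣genocchi p≢2 j 2j<p = ∣num-scaled p≢2 (4 ℕ.^ j ∸ 1) (G (2 ℕ.* j)) (B (2 ℕ.* j))
    (genocchi-even j) (integral-B (2 ℕ.* j) 2j<p)

-- The regularity criterion.

-- Division by 2: remainder 0 forces p = 2, and quotient 0 forces p = 1. The half (p-1)/2 is thus a
-- successor, as an order must be positive.
half-odd : ∀ {p} → Prime p → p ≢ 2 → ∃ λ m → p ≡ suc (suc m ℕ.* 2)
half-odd {p} pr p≢2 with p ℕ.% 2 | p / 2 | DivMod.m≡m%n+[m/n]*n p 2 | DivMod.m%n<n p 2
... | 0 | h | eq | _ with prime⇒irreducible pr (divides h eq)
...   | inj₂ 2≡p = contradiction (sym 2≡p) p≢2
half-odd pr p≢2 | 1 | zero | eq | _ = contradiction (subst Prime eq pr) ¬prime[1]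
half-odd pr p≢2 | 1 | suc m | eq | _ = m , eq
half-odd pr p≢2 | suc (suc _) | _ | _ | s≤s (s≤s ())

module _ {p} (pr : Prime p) (p≢2 : p ≢ 2) (m : ℕ) (p≡ : p ≡ suc (suc m ℕ.* 2)) where

  ≤p∸3⇒<p : ∀ j → 2 ℕ.* j ℕ.≤ p ∸ 3 → suc (2 ℕ.* j) ℕ.< p
  ≤p∸3⇒<p j rewrite p≡ = λ 2j≤ → s≤s (s≤s (ℕP.m≤n⇒m≤1+n 2j≤))

  -- With p = 2m + 3 the bound p - 3 is 2m, so the indices of the regularity conditions are exactly
  -- the positive exponents below (p-1)/2 = m + 1. For p = 3 both ranges are empty.
  ≤p∸3⇒<half : ∀ j → 2 ℕ.* j ℕ.≤ p ∸ 3 → j ℕ.< suc m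
  ≤p∸3⇒<half j rewrite p≡ | ℕP.*-comm m 2 = λ 2j≤ → s≤s (ℕP.*-cancelˡ-≤ 2 2j≤)

  <half⇒≤p∸3 : ∀ j → j ℕ.< suc m → 2 ℕ.* j ℕ.≤ p ∸ 3
  <half⇒≤p∸3 j rewrite p≡ | ℕP.*-comm m 2 = λ j<1+m → ℕP.*-monoʳ-≤ 2 (ℕP.≤-pred j<1+m)

  -- 4^((p-1)/2) = 2^(p-1), so Fermat applies.
  4^half : p ∣ 4 ℕ.^ suc m ∸ 1
  4^half = subst (λ x → p ∣ x ∸ 1)
    (trans (cong (2 ℕ.^_) (ℕP.*-comm (suc m) 2)) (sym (ℕP.^-*-assoc 2 2 (suc m))))
    (fermat₂ pr p≢2 (suc m ℕ.* 2) p≡)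

  GRegular⇔BRegular×IsOrd : GRegular p ⇔ (BRegular p × IsOrd p 4 (suc m))
  GRegular⇔BRegular×IsOrd = mk⇔ to from
    where
    module _ j (2j≤ : 2 ℕ.* j ℕ.≤ p ∸ 3) where
      open Equivalence (∣genocchi pr p≢2 j (≤p∸3⇒<p j 2j≤)) public
        renaming (to to ∣G⇒; from to ⇒∣G)
    to : GRegular p → BRegular p × IsOrd p 4 (suc m)
    to gr = (λ j 1≤j 2j≤ p∣B → gr j 1≤j 2j≤ (⇒∣G j 2j≤ (inj₂ p∣B)))
          , s≤s z≤n
          , 4^half
          -- A smaller exponent with 4^j ≡ 1 would make p divide G_{2j}, against G-regularity.
          , λ j 0<j j<1+m p∣4ʲ∸1 →
              let 2j≤ = <half⇒≤p∸3 j j<1+m in gr j 0<j 2j≤ (⇒∣G j 2j≤ (inj₁ p∣4ʲ∸1))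
    from : BRegular p × IsOrd p 4 (suc m) → GRegular p
    from (br , _ , _ , minimal) j 1≤j 2j≤ p∣G =
      [ minimal j 1≤j (≤p∸3⇒<half j 2j≤) , br j 1≤j 2j≤ ]′ (∣G⇒ j 2j≤ p∣G)

theorem1p8 : (p : ℕ) → OddPrime p →
    (GRegular p ⇔ (BRegular p × IsOrd p 4 ((p ∸ 1) / 2)))
theorem1p8 p (pr , p≢2) with half-odd pr p≢2
-- The order was treated as m + 1; here it is rewritten as (p-1)/2.
... | m , p≡ = subst (λ k → GRegular p ⇔ (BRegular p × IsOrd p 4 k))
    (sym (trans (cong (λ q → (q ∸ 1) / 2) p≡) (DivMod.m*n/n≡m (suc m) 2)))
    (GRegular⇔BRegular×IsOrd pr p≢2 m p≡)
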